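{- There is a function $f:\mathbb{N}^3\rightarrow\mathbb{N}$ such that for all $t,k,\lambda\in\mathbb{N}$, every bipartite graph with average degree $d\geq f(t,k,\lambda)$ and maximum degree at most $\lambda d$ has either a $K_{t,t}$-subgraph or an induced subgraph of average degree at least $t$ and girth at least $k$.
   Context: All graphs are finite and simple. A $K_{t,t}$-subgraph is a (not necessarily induced) subgraph isomorphic to the complete bipartite graph $K_{t,t}$. The girth of a graph is the length of its shortest cycle (infinite if the graph has no cycle). -}

module Defs where

open import Data.Nat using (ℕ; zero; suc; _+_; _*_; _≤_; _<_)
open import Data.Bool using (Bool; true; false; if_then_else_)
open import Data.Fin using (Fin; zero; suc; inject₁; fromℕ)
open import Data.List using (map; allFin)
open import Data.Nat.ListAction using (sum)
open import Data.Product using (Σ; _×_; _,_)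
open import Relation.Binary.PropositionalEquality using (_≡_; _≢_)
open import Function.Definitions using (Injective)

record Graph : Set where
  field
    n     : ℕ
    adj   : Fin n → Fin n → Bool
    sym   : ∀ u v → adj u v ≡ adj v u
    irrefl : ∀ v → adj v v ≡ false
open Graph public

Adj : (G : Graph) → Fin (n G) → Fin (n G) → Set
Adj G u v = adj G u v ≡ true

deg : (G : Graph) → Fin (n G) → ℕ
deg G v = sum (map (λ w → if adj G v w then 1 else 0) (allFin (n G)))

degSum : (G : Graph) → ℕ
degSum G = sum (map (deg G) (allFin (n G)))

-- average degree ≥ a   (cross-multiplied: degSum / n ≥ a)
AvgDeg≥ : Graph → ℕ → Set
AvgDeg≥ G a = a * n G ≤ degSum G

-- maximum degree ≤ λ · (average degree)   (cross-multiplied by n)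
MaxDeg≤λAvg : Graph → ℕ → Set
MaxDeg≤λAvg G λ' = ∀ v → n G * deg G v ≤ λ' * degSum G

Bipartite : Graph → Set
Bipartite G = Σ (Fin (n G) → Bool) λ c → ∀ u v → Adj G u v → c u ≢ c v

HasKtt : ℕ → Graph → Set
HasKtt t G = Σ (Fin t → Fin (n G)) λ a → Σ (Fin t → Fin (n G)) λ b →
  Injective _≡_ _≡_ a × Injective _≡_ _≡_ b × (∀ i j → a i ≢ b j) ×
  (∀ i j → Adj G (a i) (b j))

induced : (G : Graph) (m : ℕ) (e : Fin m → Fin (n G)) → Graph
induced G m e = record
  { n = m
  ; adj = λ i j → adj G (e i) (e j)
  ; sym = λ i j → sym G (e i) (e j)
  ; irrefl = λ i → irrefl G (e i)
  }

Cycle : (G : Graph) (j : ℕ) → Set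
Cycle G j = Σ (Fin (3 + j) → Fin (n G)) λ v →
  Injective _≡_ _≡_ v ×
  (∀ (i : Fin (2 + j)) → Adj G (v (inject₁ i)) (v (suc i))) ×
  Adj G (v (fromℕ (2 + j))) (v zero)

Girth≥ : Graph → ℕ → Set
Girth≥ G k = ∀ j → Cycle G j → k ≤ 3 + j

{-# OPTIONS --safe #-}

-- Let D be about λ times the average degree, so that all degrees are at most D. If G has no
-- K_{t,t}, then by Kővári–Sós–Turán any two neighbourhoods span at most D² / M edges, so a
-- vertex starts at most D^(j+2) / M closed walks of length j + 3. Keep each vertex with
-- probability about K / D, where K = λ (t + 2). In expectation the sampled degrees are at least
-- about K / λ = t + 2, while few sampled edges meet short sampled cycles, as M is large compared
-- with K. So for some sample, deleting every vertex on a short cycle leaves the required subgraph.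
module Submission where

open import Defs hiding (sym)
open import Data.Bool using (Bool; true; false; if_then_else_; _∧_)
import Data.Bool as Bool
open import Data.Fin using (Fin; zero; suc; inject₁; inject≤; fromℕ; finToFun; funToFin)
open import Data.Fin.Properties using (inject≤-injective; finToFun-funToFin; any?) renaming (_≟_ to _≟ᶠ_)
open import Data.List using (List; []; _∷_; _++_; map; allFin; length; lookup; filter; cartesianProductWith; upTo)
open import Data.List.Properties using (map-∘; map-++; map-tabulate; tabulate-lookup; length-tabulate)
open import Data.List.Membership.Propositional using (_∈_)
open import Data.List.Membership.Propositional.Properties
  using (∈-lookup; ∈-allFin; ∈-upTo⁺; ∈-cartesianProductWith⁺)
import Data.List.Relation.Unary.All as All
open import Data.List.Relation.Unary.All.Properties using (all-filter)
open import Data.List.Relation.Unary.Any using (here; there)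
open import Data.List.Relation.Unary.Unique.Propositional using (Unique; _∷_)
open import Data.List.Relation.Unary.Unique.Propositional.Properties using (allFin⁺; filter⁺)
open import Data.Nat
open import Data.Nat.DivMod using (_/_; _%_; m≡m%n+[m/n]*n; m%n<n; m*n/n≡m; /-monoˡ-≤; m≥n⇒m/n>0; m/n*n≤m)
open import Data.Nat.ListAction using (sum)
open import Data.Nat.ListAction.Properties using (sum-++)
open import Data.Nat.Properties
open import Data.Nat.Tactic.RingSolver using (solve-∀)
open import Data.Product using (Σ; ∃; _×_; _,_; proj₁; proj₂)
open import Data.Sum using (_⊎_; inj₁; inj₂; map₂)
open import Data.Vec using (Vec; []; _∷_; _[_]≔_; tabulate; replicate) renaming (lookup to lookupᵛ)
open import Data.Vec.Properties using (lookup∘update′)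
open import Data.Vec.Relation.Unary.All using ([]; _∷_) renaming (All to Allᵛ; all? to allᵛ?)
open import Data.Vec.Relation.Unary.AllPairs using (allPairs?)
open import Data.Vec.Relation.Unary.Unique.Propositional using ([]; _∷_) renaming (Unique to Uniqueᵛ)
open import Data.Vec.Relation.Unary.Unique.Propositional.Properties using (tabulate⁺)
open import Function using (_∘_; id)
open import Function.Definitions using (Injective)
open import Relation.Binary.PropositionalEquality
open import Relation.Nullary using (¬_; Dec; yes; no; does; contradiction; ¬?)
open import Relation.Nullary.Decidable using (dec-true)

-- The loss to control is, at each vertex z, the product of the sampled degree of z with the number
-- of sampled short cycles through z. The two factors are dependent: a neighbour of z that lies on
-- the cycle is sampled for free. But a cycle of length j + 3 has only j + 3 vertices, and when
-- vertices are sampled with probability 1 / q, q about D / K, the resulting term (j + 3) q is of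
-- the same order as the term D from the neighbours off the cycle. So the expected loss at z is at
-- most C / (M q), where the constant C depends on K and k alone. Hence M may be chosen after C, and
-- only then the lower bound on D under which Kővári-Sós-Turán saves the factor M. Some saving is
-- indispensable: the trivial count of closed walks bounds the loss only by C n / q, and the
-- expected number of sampled vertices is itself n / q. All of this is carried out in natural
-- numbers: expectations are sums over all colourings with q colours, and inequalities are
-- multiplied out by powers of q and by the number of colourings.

private variable
  A B C : Set

-- Indicators and finite sums.

𝟙 : Bool → ℕ
𝟙 b = if b then 1 else 0

𝟙≤1 : ∀ b → 𝟙 b ≤ 1
𝟙≤1 true  = ≤-refl
𝟙≤1 false = z≤n

𝟙-∧ : ∀ a b → 𝟙 (a ∧ b) ≡ 𝟙 a * 𝟙 b
𝟙-∧ true  b = sym (+-identityʳ (𝟙 b))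
𝟙-∧ false b = refl

opaque
  ∑ : List A → (A → ℕ) → ℕ
  ∑ xs f = sum (map f xs)

  ∑-cong : ∀ (xs : List A) {f g} → (∀ x → f x ≡ g x) → ∑ xs f ≡ ∑ xs g
  ∑-cong []       f≡g = refl
  ∑-cong (x ∷ xs) f≡g = cong₂ _+_ (f≡g x) (∑-cong xs f≡g)

  ∑-mono : ∀ (xs : List A) {f g} → (∀ x → f x ≤ g x) → ∑ xs f ≤ ∑ xs g
  ∑-mono []       f≤g = z≤n
  ∑-mono (x ∷ xs) f≤g = +-mono-≤ (f≤g x) (∑-mono xs f≤g)

  ∑-distrib-+ : ∀ (xs : List A) f g → ∑ xs (λ x → f x + g x) ≡ ∑ xs f + ∑ xs g
  ∑-distrib-+ []       f g = refl
  ∑-distrib-+ (x ∷ xs) f g rewrite ∑-distrib-+ xs f g = interchange (f x) (g x) (∑ xs f) (∑ xs g)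
    where
    interchange : ∀ a b c d → (a + b) + (c + d) ≡ (a + c) + (b + d)
    interchange = solve-∀

  *-distribˡ-∑ : ∀ (xs : List A) c f → c * ∑ xs f ≡ ∑ xs (λ x → c * f x)
  *-distribˡ-∑ []       c f = *-zeroʳ c
  *-distribˡ-∑ (x ∷ xs) c f = trans (*-distribˡ-+ c (f x) _) (cong (c * f x +_) (*-distribˡ-∑ xs c f))

  *-distribʳ-∑ : ∀ (xs : List A) c f → ∑ xs f * c ≡ ∑ xs (λ x → f x * c)
  *-distribʳ-∑ xs c f =
    trans (*-comm (∑ xs f) c) (trans (*-distribˡ-∑ xs c f) (∑-cong xs λ x → *-comm c (f x)))

  ∑-const : ∀ (xs : List A) c → ∑ xs (λ _ → c) ≡ length xs * c
  ∑-const []       c = refl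
  ∑-const (x ∷ xs) c = cong (c +_) (∑-const xs c)

  ∑-comm : ∀ (xs : List A) (ys : List B) (f : A → B → ℕ) →
           ∑ xs (λ x → ∑ ys (f x)) ≡ ∑ ys (λ y → ∑ xs (λ x → f x y))
  ∑-comm []       ys f = sym (trans (∑-const ys 0) (*-zeroʳ (length ys)))
  ∑-comm (x ∷ xs) ys f =
    trans (cong (∑ ys (f x) +_) (∑-comm xs ys f)) (sym (∑-distrib-+ ys (f x) _))

  ∑-++ : ∀ (xs ys : List A) f → ∑ (xs ++ ys) f ≡ ∑ xs f + ∑ ys f
  ∑-++ xs ys f = trans (cong sum (map-++ f xs ys)) (sum-++ (map f xs) (map f ys))

  ∑-map : ∀ (xs : List A) (h : A → B) f → ∑ (map h xs) f ≡ ∑ xs (f ∘ h)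
  ∑-map xs h f = cong sum (sym (map-∘ xs))

  ∑-cartesianProductWith : ∀ (h : A → B → C) xs ys f →
    ∑ (cartesianProductWith h xs ys) f ≡ ∑ xs (λ x → ∑ ys (λ y → f (h x y)))
  ∑-cartesianProductWith h []       ys f = refl
  ∑-cartesianProductWith h (x ∷ xs) ys f =
    trans (∑-++ (map (h x) ys) _ f) (cong₂ _+_ (∑-map ys (h x) f) (∑-cartesianProductWith h xs ys f))

  ∑-filter : ∀ (P : A → Bool) xs f →
    ∑ (filter (λ x → P x Bool.≟ true) xs) f ≡ ∑ xs (λ x → 𝟙 (P x) * f x)
  ∑-filter P []       f = refl
  ∑-filter P (x ∷ xs) f with P x
  ... | true  = cong₂ _+_ (sym (+-identityʳ (f x))) (∑-filter P xs f)
  ... | false = ∑-filter P xs f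

  ∑-∈ : ∀ {x : A} {xs} f → x ∈ xs → f x ≤ ∑ xs f
  ∑-∈ {xs = y ∷ ys} f (here refl) = m≤m+n (f y) _
  ∑-∈ {xs = y ∷ ys} f (there x∈)  = ≤-trans (∑-∈ f x∈) (m≤n+m _ (f y))

  -- The first-moment method. It extracts the popular class in `pigeonhole` and, at the very end,
  -- the good colouring.
  ∑-<⇒∃ : ∀ (xs : List A) f g → ∑ xs f < ∑ xs g → ∃ λ x → f x < g x
  ∑-<⇒∃ (x ∷ xs) f g lt with f x <? g x
  ... | yes fx<gx = x , fx<gx
  ... | no  fx≮gx = ∑-<⇒∃ xs f g (+-cancelˡ-< (f x) _ _ (≤-trans lt (+-monoˡ-≤ _ (≮⇒≥ fx≮gx))))

  length-allFin : ∀ n → length (allFin n) ≡ n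
  length-allFin n = length-tabulate id

  ∑-allFin-suc : ∀ n (f : Fin (suc n) → ℕ) → ∑ (allFin (suc n)) f ≡ f zero + ∑ (allFin n) (f ∘ suc)
  ∑-allFin-suc n f = cong (λ s → f zero + sum s)
    (trans (map-tabulate suc f) (sym (map-tabulate id (f ∘ suc))))

  ∑-lookup : ∀ (xs : List A) f → ∑ (allFin (length xs)) (f ∘ lookup xs) ≡ ∑ xs f
  ∑-lookup xs f = cong sum (trans (map-tabulate id (f ∘ lookup xs))
    (trans (sym (map-tabulate (lookup xs) f)) (cong (map f) (tabulate-lookup xs))))

∑-≟ : ∀ n (i : Fin n) → ∑ (allFin n) (λ j → 𝟙 (does (j ≟ᶠ i))) ≡ 1
∑-≟ (suc n) zero    = trans (∑-allFin-suc n _)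
  (cong suc (trans (∑-const (allFin n) 0) (*-zeroʳ (length (allFin n)))))
∑-≟ (suc n) (suc i) = trans (∑-allFin-suc n (λ j → 𝟙 (does (j ≟ᶠ suc i)))) (∑-≟ n i)

-- Selecting elements of a decidable set, and the pigeonhole principle.

lookup-injective : ∀ {xs : List A} → Unique xs → Injective _≡_ _≡_ (lookup xs)
lookup-injective (px ∷ u) {zero}  {zero}  eq = refl
lookup-injective (px ∷ u) {zero}  {suc j} eq = contradiction eq (All.lookup px (∈-lookup j))
lookup-injective (px ∷ u) {suc i} {zero}  eq = contradiction (sym eq) (All.lookup px (∈-lookup i))
lookup-injective (px ∷ u) {suc i} {suc j} eq = cong suc (lookup-injective u eq)

module _ {n} (P : Fin n → Bool) where

  members : List (Fin n)
  members = filter (λ x → P x Bool.≟ true) (allFin n)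

  members-injective : Injective _≡_ _≡_ (lookup members)
  members-injective = lookup-injective (filter⁺ (λ x → P x Bool.≟ true) (allFin⁺ n))

  members-satisfy : ∀ i → P (lookup members i) ≡ true
  members-satisfy i = All.lookup (all-filter (λ x → P x Bool.≟ true) (allFin n)) (∈-lookup i)

  ∑-members : ∀ f → ∑ (allFin (length members)) (f ∘ lookup members) ≡ ∑ (allFin n) (λ x → 𝟙 (P x) * f x)
  ∑-members f = trans (∑-lookup members f) (∑-filter P (allFin n) f)

  length-members : length members ≡ ∑ (allFin n) (𝟙 ∘ P)
  length-members = trans (sym (*-identityʳ _)) (trans (sym (∑-const members 1))
    (trans (∑-filter P (allFin n) (λ _ → 1)) (∑-cong (allFin n) λ x → *-identityʳ (𝟙 (P x)))))

  choose : ∀ {k} → k ≤ ∑ (allFin n) (𝟙 ∘ P) →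
           Σ (Fin k → Fin n) λ g → Injective _≡_ _≡_ g × (∀ i → P (g i) ≡ true)
  choose k≤ = (λ i → lookup members (inject≤ i k≤len))
    , (λ eq → inject≤-injective k≤len k≤len _ _ (members-injective eq))
    , (λ i → members-satisfy (inject≤ i k≤len))
    where
    k≤len = subst (_ ≤_) (sym length-members) k≤

pigeonhole : ∀ {m k t} (f : Fin m → Fin k) → k * t < m →
             ∃ λ κ → t < ∑ (allFin m) (λ i → 𝟙 (does (f i ≟ᶠ κ)))
pigeonhole {m} {k} {t} f kt<m = ∑-<⇒∃ (allFin k) (λ _ → t) _ (begin-strict
  ∑ (allFin k) (λ _ → t)  ≡⟨ trans (∑-const (allFin k) t) (cong (_* t) (length-allFin k)) ⟩
  k * t                   <⟨ kt<m ⟩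
  m                       ≡⟨ sym (*-identityʳ m) ⟩
  m * 1                   ≡⟨ cong (_* 1) (sym (length-allFin m)) ⟩
  length (allFin m) * 1   ≡⟨ sym (∑-const (allFin m) 1) ⟩
  -- Double counting: each i lies in exactly one class, so the class sizes add up to m.
  ∑ (allFin m) (λ _ → 1)  ≡⟨ ∑-cong (allFin m) (λ i → sym (trans (∑-cong (allFin k) λ κ → swap (f i) κ) (∑-≟ k (f i)))) ⟩
  ∑ (allFin m) (λ i → ∑ (allFin k) (λ κ → 𝟙 (does (f i ≟ᶠ κ))))  ≡⟨ ∑-comm (allFin m) (allFin k) _ ⟩
  ∑ (allFin k) (λ κ → ∑ (allFin m) (λ i → 𝟙 (does (f i ≟ᶠ κ)))) ∎)
  where
  open ≤-Reasoning
  swap : ∀ {k} (i j : Fin k) → 𝟙 (does (i ≟ᶠ j)) ≡ 𝟙 (does (j ≟ᶠ i))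
  swap i j with i ≟ᶠ j | j ≟ᶠ i
  ... | yes _ | yes _ = refl
  ... | no _  | no _  = refl
  ... | yes p | no q  = contradiction (sym p) q
  ... | no p  | yes q = contradiction (sym q) p

-- Bicliques between dense pairs of sets.

∧-true : ∀ {a b} → a ∧ b ≡ true → a ≡ true × b ≡ true
∧-true {true} {true} _ = refl , refl

does-true : ∀ {P : Set} (p? : Dec P) → does p? ≡ true → P
does-true (yes p) _ = p

-- The averaging step of both counts in Kővári-Sós-Turán: a value reaching T is charged the upper
-- bound U, any other is charged T. A large total therefore forces many values to reach T.
threshold : ∀ b {T v U} (p? : Dec (T ≤ v)) → v ≤ U → 𝟙 b * v ≤ 𝟙 (b ∧ does p?) * U + 𝟙 b * T
threshold false p?      v≤U = z≤n
threshold true  (yes _) v≤U = ≤-trans (*-monoʳ-≤ 1 v≤U) (m≤m+n _ _)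
threshold true  (no ¬p) v≤U = *-monoʳ-≤ 1 (<⇒≤ (≰⇒> ¬p))

Biclique : ∀ {n} → (Fin n → Fin n → Bool) → ℕ → Set
Biclique {n} R t = Σ (Fin t → Fin n) λ a → Σ (Fin t → Fin n) λ b →
  Injective _≡_ _≡_ a × Injective _≡_ _≡_ b × (∀ i j → R (a i) (b j) ≡ true)

module _ {n} (R : Fin n → Fin n → Bool) where

  -- Each x i picks t of its neighbours in g; there are only N ^ t possible picks.
  biclique-by-pigeonhole : ∀ {s N t} (x : Fin s → Fin n) (g : Fin N → Fin n) →
    Injective _≡_ _≡_ x → Injective _≡_ _≡_ g →
    (∀ i → t ≤ ∑ (allFin N) (λ j → 𝟙 (R (x i) (g j)))) →
    N ^ t * t < s → Biclique R t
  biclique-by-pigeonhole {s} {N} {t} x g x-inj g-inj many Nᵗt<s =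
    x ∘ e , g ∘ finToFun κ , e-inj ∘ x-inj , b-inj , adjacent
    where
    picks : ∀ i → Σ (Fin t → Fin N) λ h → Injective _≡_ _≡_ h × (∀ j → R (x i) (g (h j)) ≡ true)
    picks i = choose (λ j → R (x i) (g j)) (many i)
    pick = λ i → proj₁ (picks i)
    popular = pigeonhole (λ i → funToFin (pick i)) Nᵗt<s
    κ = proj₁ popular
    chosen = choose (λ i → does (funToFin (pick i) ≟ᶠ κ)) (<⇒≤ (proj₂ popular))
    e = proj₁ chosen
    e-inj = proj₁ (proj₂ chosen)
    same : ∀ i j → finToFun κ j ≡ pick (e i) j
    same i j = trans (cong (λ c → finToFun c j) (sym (does-true (_ ≟ᶠ κ) (proj₂ (proj₂ chosen) i))))
                     (finToFun-funToFin (pick (e i)) j)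
    -- All vertices of the popular class share one pick, so injectivity can be read off any of them;
    -- the index `i` itself names one, namely `e i`.
    b-inj : Injective _≡_ _≡_ (g ∘ finToFun κ)
    b-inj {i} {j} eq = proj₁ (proj₂ (picks (e i)))
      (trans (sym (same i i)) (trans (g-inj eq) (same i j)))
    adjacent : ∀ i j → R (x (e i)) (g (finToFun κ j)) ≡ true
    adjacent i j = trans (cong (R (x (e i)) ∘ g) (same i j)) (proj₂ (proj₂ (picks (e i))) j)

  module KővariSósTurán (A B : Fin n → Bool) (t M D : ℕ)
    (|A|≤D : ∑ (allFin n) (𝟙 ∘ A) ≤ D) (|B|≤D : ∑ (allFin n) (𝟙 ∘ B) ≤ D) where

    -- The size makes the second count work: N rich vertices, with at least D / 2M neighbours in A
    -- each, send at least 2tD edges to A. Vertices of A receiving fewer than t of these absorb at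
    -- most tD, and the others at most N each, so at least tD / N = D / 4M vertices receive t or
    -- more.
    N : ℕ
    N = 4 * M * t

    V = allFin n

    degA : Fin n → ℕ
    degA b = ∑ V λ a → 𝟙 (A a) * 𝟙 (R a b)

    edges : ℕ
    edges = ∑ V λ b → degA b * 𝟙 (B b)

    degA≤D : ∀ b → degA b ≤ D
    degA≤D b = ≤-trans (∑-mono V λ a → ≤-trans (*-monoʳ-≤ (𝟙 (A a)) (𝟙≤1 (R a b))) (≤-reflexive (*-identityʳ _))) |A|≤D

    rich : Fin n → Bool
    rich b = B b ∧ does (D ≤? 2 * M * degA b)

    edge-at : ∀ b → 2 * M * (degA b * 𝟙 (B b)) ≤ 𝟙 (rich b) * (2 * M * D) + 𝟙 (B b) * D
    edge-at b = ≤-trans (≤-reflexive (rearrange (2 * M) (degA b) (𝟙 (B b))))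
      (threshold (B b) (D ≤? 2 * M * degA b) (*-monoʳ-≤ (2 * M) (degA≤D b)))
      where
      rearrange : ∀ m d b → m * (d * b) ≡ b * (m * d)
      rearrange = solve-∀

    #rich : ℕ
    #rich = ∑ V (𝟙 ∘ rich)

    open ≤-Reasoning

    -- Vertices of B that are not rich have fewer than D / 2M neighbours in A, so together they
    -- account for at most D² / 2M edges, less than half. The other half falls on rich vertices, at
    -- most D edges on each.
    rich-lower : D * D < M * edges → D < 2 * M * #rich
    rich-lower dense = *-cancelʳ-< D D (2 * M * #rich) (+-cancelʳ-< (D * D) _ _ (begin-strict
      D * D + D * D                     <⟨ +-mono-< dense dense ⟩
      M * edges + M * edges             ≡⟨ double M edges ⟩
      2 * M * edges                     ≡⟨ *-distribˡ-∑ V (2 * M) _ ⟩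
      ∑ V (λ b → 2 * M * (degA b * 𝟙 (B b)))  ≤⟨ ∑-mono V edge-at ⟩
      ∑ V (λ b → 𝟙 (rich b) * (2 * M * D) + 𝟙 (B b) * D)  ≡⟨ ∑-distrib-+ V _ _ ⟩
      ∑ V (λ b → 𝟙 (rich b) * (2 * M * D)) + ∑ V (λ b → 𝟙 (B b) * D)
        ≡⟨ sym (cong₂ _+_ (*-distribʳ-∑ V _ _) (*-distribʳ-∑ V _ _)) ⟩
      #rich * (2 * M * D) + ∑ V (𝟙 ∘ B) * D  ≤⟨ +-mono-≤ (≤-reflexive (rearrange #rich M D)) (*-monoˡ-≤ D |B|≤D) ⟩
      2 * M * #rich * D + D * D ∎))
      where
      double : ∀ M e → M * e + M * e ≡ 2 * M * e
      double = solve-∀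
      rearrange : ∀ r M D → r * (2 * M * D) ≡ 2 * M * r * D
      rearrange = solve-∀

    biclique : .{{NonZero M}} → .{{NonZero t}} → 2 * M * N ≤ D → 4 * M * (N ^ t * t) < D →
               D * D < M * edges → Biclique R t
    biclique D≥₁ D≥₂ dense =
      -- `choose good enough` selects exactly `suc (N ^ t * t)` vertices, so the inequality for the
      -- pigeonhole holds by reflexivity.
      biclique-by-pigeonhole x g x-inj g-inj (λ i → does-true (t ≤? degN (x i)) (proj₂ (∧-true (x-good i)))) ≤-refl
      where
      rich≥N : N ≤ #rich
      rich≥N = *-cancelˡ-≤ (2 * M) {{m*n≢0 2 M}} (≤-trans D≥₁ (<⇒≤ (rich-lower dense)))
      gs = choose rich rich≥N
      g = proj₁ gs
      g-inj = proj₁ (proj₂ gs)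
      g-rich : ∀ i → D ≤ 2 * M * degA (g i)
      g-rich i = does-true (D ≤? 2 * M * degA (g i)) (proj₂ (∧-true (proj₂ (proj₂ gs) i)))
      degN : Fin n → ℕ
      degN a = ∑ (allFin N) λ i → 𝟙 (R a (g i))
      degN≤N : ∀ a → degN a ≤ N
      degN≤N a = begin
        degN a               ≤⟨ ∑-mono (allFin N) (λ i → 𝟙≤1 (R a (g i))) ⟩
        ∑ (allFin N) (λ _ → 1) ≡⟨ trans (∑-const (allFin N) 1) (trans (*-identityʳ _) (length-allFin N)) ⟩
        N ∎
      good : Fin n → Bool
      good a = A a ∧ does (t ≤? degN a)
      #good = ∑ V (𝟙 ∘ good)
      edge-from : ∀ a → 𝟙 (A a) * degN a ≤ 𝟙 (good a) * N + 𝟙 (A a) * t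
      edge-from a = threshold (A a) (t ≤? degN a) (degN≤N a)
      few : N * D ≤ 2 * M * (#good * N + D * t)
      few = begin
        N * D                                   ≡⟨ sym (trans (∑-const (allFin N) D) (cong (_* D) (length-allFin N))) ⟩
        ∑ (allFin N) (λ _ → D)                  ≤⟨ ∑-mono (allFin N) g-rich ⟩
        ∑ (allFin N) (λ i → 2 * M * degA (g i)) ≡⟨ sym (*-distribˡ-∑ (allFin N) (2 * M) _) ⟩
        2 * M * ∑ (allFin N) (degA ∘ g)         ≡⟨ cong (2 * M *_) (∑-comm (allFin N) V _) ⟩
        2 * M * ∑ V (λ a → ∑ (allFin N) λ i → 𝟙 (A a) * 𝟙 (R a (g i)))
          ≡⟨ cong (2 * M *_) (∑-cong V λ a → sym (*-distribˡ-∑ (allFin N) (𝟙 (A a)) _)) ⟩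
        2 * M * ∑ V (λ a → 𝟙 (A a) * degN a)    ≤⟨ *-monoʳ-≤ (2 * M) (∑-mono V edge-from) ⟩
        2 * M * ∑ V (λ a → 𝟙 (good a) * N + 𝟙 (A a) * t)
          ≡⟨ cong (2 * M *_) (trans (∑-distrib-+ V _ _) (sym (cong₂ _+_ (*-distribʳ-∑ V N _) (*-distribʳ-∑ V t _)))) ⟩
        2 * M * (#good * N + ∑ V (𝟙 ∘ A) * t)   ≤⟨ *-monoʳ-≤ (2 * M) (+-monoʳ-≤ (#good * N) (*-monoˡ-≤ t |A|≤D)) ⟩
        2 * M * (#good * N + D * t) ∎
      D≤good : D ≤ 4 * M * #good
      D≤good = *-cancelˡ-≤ (2 * M * t) {{m*n≢0 (2 * M) t {{m*n≢0 2 M}}}}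
        (+-cancelʳ-≤ (2 * M * t * D) _ _ (begin
          2 * M * t * D + 2 * M * t * D  ≡⟨ lhs M t D ⟩
          N * D                          ≤⟨ few ⟩
          2 * M * (#good * N + D * t)    ≡⟨ rhs M t D #good ⟩
          2 * M * t * (4 * M * #good) + 2 * M * t * D ∎))
        where
        lhs : ∀ M t D → 2 * M * t * D + 2 * M * t * D ≡ 4 * M * t * D
        lhs = solve-∀
        rhs : ∀ M t D s → 2 * M * (s * (4 * M * t) + D * t) ≡ 2 * M * t * (4 * M * s) + 2 * M * t * D
        rhs = solve-∀
      enough : N ^ t * t < #good
      enough = *-cancelˡ-< (4 * M) _ _ (≤-trans D≥₂ D≤good)
      xs = choose good enough
      x = proj₁ xs
      x-inj = proj₁ (proj₂ xs)
      x-good = proj₂ (proj₂ xs)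

-- Vectors, which serve both as walks and as colourings, and random sampling.

allVecs : ∀ a m → List (Vec (Fin a) m)
allVecs a zero    = [] ∷ []
allVecs a (suc m) = cartesianProductWith _∷_ (allFin a) (allVecs a m)

∈-allVecs : ∀ {a m} (xs : Vec (Fin a) m) → xs ∈ allVecs a m
∈-allVecs []       = here refl
∈-allVecs (x ∷ xs) = ∈-cartesianProductWith⁺ _∷_ (∈-allFin x) (∈-allVecs xs)

∑-allVecs-suc : ∀ a m (f : Vec (Fin a) (suc m) → ℕ) →
  ∑ (allVecs a (suc m)) f ≡ ∑ (allFin a) λ x → ∑ (allVecs a m) λ xs → f (x ∷ xs)
∑-allVecs-suc a m f = ∑-cartesianProductWith _∷_ (allFin a) (allVecs a m) f

∑-allFin-const : ∀ n c → ∑ (allFin n) (λ _ → c) ≡ n * c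
∑-allFin-const n c = trans (∑-const (allFin n) c) (cong (_* c) (length-allFin n))

occurrences : ∀ {n m} → Fin n → Vec (Fin n) m → ℕ
occurrences w []       = 0
occurrences w (x ∷ xs) = 𝟙 (does (w ≟ᶠ x)) + occurrences w xs

∑-occurrences : ∀ {n m} (xs : Vec (Fin n) m) → ∑ (allFin n) (λ w → occurrences w xs) ≡ m
∑-occurrences {n} []       = trans (∑-allFin-const n 0) (*-zeroʳ n)
∑-occurrences {n} (x ∷ xs) = trans (∑-distrib-+ (allFin n) _ _) (cong₂ _+_ (∑-≟ n x) (∑-occurrences xs))

occurrences>0 : ∀ {n m} {w : Fin n} {xs : Vec (Fin n) m} → ¬ Allᵛ (w ≢_) xs → 1 ≤ occurrences w xs
occurrences>0 {xs = []}                ¬all = contradiction [] ¬all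
occurrences>0 {w = w} {xs = x ∷ xs} ¬all with w ≟ᶠ x
... | yes _   = s≤s z≤n
... | no  w≢x = occurrences>0 (¬all ∘ (w≢x ∷_))

-- A colouring with 1 + r colours stands for the random vertex set of its colour class 0,
-- which contains each vertex independently with probability 1 / (1 + r).
Colouring : ℕ → ℕ → Set
Colouring r n = Vec (Fin (suc r)) n

isZero : ∀ {r} → Fin (suc r) → Bool
isZero zero    = true
isZero (suc _) = false

sampled : ∀ {r n} → Colouring r n → Fin n → Bool
sampled c v = isZero (lookupᵛ c v)

-- The indicator of an intersection of events, written as a product so that `𝔼-sampled` can peel off
-- one vertex at a time.
allSampled : ∀ {r n m} → Vec (Fin n) m → Colouring r n → ℕ
allSampled []       c = 1
allSampled (x ∷ xs) c = 𝟙 (sampled c x) * allSampled xs c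

allSampled-all : ∀ {r n m} (c : Colouring r n) (p : Fin m → Fin n) →
  (∀ i → sampled c (p i) ≡ true) → allSampled (tabulate p) c ≡ 1
allSampled-all {m = zero}  c p all = refl
allSampled-all {m = suc m} c p all = cong₂ _*_ (cong 𝟙 (all zero)) (allSampled-all c (p ∘ suc) (all ∘ suc))

∑-isZero : ∀ r c → ∑ (allFin (suc r)) (λ x → 𝟙 (isZero x) * c) ≡ c
∑-isZero r c = begin
  ∑ (allFin (suc r)) (λ x → 𝟙 (isZero x) * c) ≡⟨ ∑-allFin-suc r _ ⟩
  1 * c + ∑ (allFin r) (λ _ → 0)              ≡⟨ cong (1 * c +_) (trans (∑-allFin-const r 0) (*-zeroʳ r)) ⟩
  1 * c + 0                                   ≡⟨ trans (+-identityʳ _) (*-identityˡ c) ⟩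
  c ∎
  where open ≡-Reasoning

module _ (r : ℕ) where

  colourings : ∀ n → List (Colouring r n)
  colourings = allVecs (suc r)

  -- 𝔼 is unnormalised: the probability space has total mass 𝔼 (λ _ → 1).
  𝔼 : ∀ {n} → (Colouring r n → ℕ) → ℕ
  𝔼 {n} = ∑ (colourings n)

  -- Independence: F ignores the colour of v, and once all other colours are fixed, exactly one of
  -- the `suc r` colours of v puts it in the sample.
  𝔼-sampled : ∀ {n} (v : Fin n) (F : Colouring r n → ℕ) → (∀ x c → F (c [ v ]≔ x) ≡ F c) →
             suc r * 𝔼 (λ c → 𝟙 (sampled c v) * F c) ≡ 𝔼 F
  𝔼-sampled {suc n} zero F inv = begin
    suc r * 𝔼 (λ c → 𝟙 (sampled c zero) * F c)
      ≡⟨ cong (suc r *_) (∑-allVecs-suc (suc r) n _) ⟩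
    suc r * ∑ (allFin (suc r)) (λ x → ∑ (colourings n) λ c → 𝟙 (isZero x) * F (x ∷ c))
      ≡⟨ cong (suc r *_) (∑-cong (allFin (suc r)) λ x →
           trans (∑-cong (colourings n) λ c → cong (𝟙 (isZero x) *_) (inv x (zero ∷ c)))
                 (sym (*-distribˡ-∑ (colourings n) (𝟙 (isZero x)) _))) ⟩
    suc r * ∑ (allFin (suc r)) (λ x → 𝟙 (isZero x) * F₀)
      ≡⟨ cong (suc r *_) (∑-isZero r F₀) ⟩
    suc r * F₀
      ≡⟨ sym (∑-allFin-const (suc r) F₀) ⟩
    ∑ (allFin (suc r)) (λ _ → F₀)
      ≡⟨ ∑-cong (allFin (suc r)) (λ x → ∑-cong (colourings n) λ c → sym (inv x (zero ∷ c))) ⟩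
    ∑ (allFin (suc r)) (λ x → ∑ (colourings n) λ c → F (x ∷ c))
      ≡⟨ sym (∑-allVecs-suc (suc r) n F) ⟩
    𝔼 F ∎
    where
    open ≡-Reasoning
    F₀ = 𝔼 λ c → F (zero ∷ c)
  𝔼-sampled {suc n} (suc v) F inv = begin
    suc r * 𝔼 (λ c → 𝟙 (sampled c (suc v)) * F c)
      ≡⟨ cong (suc r *_) (∑-allVecs-suc (suc r) n _) ⟩
    suc r * ∑ (allFin (suc r)) (λ x → 𝔼 λ c → 𝟙 (sampled c v) * F (x ∷ c))
      ≡⟨ *-distribˡ-∑ (allFin (suc r)) (suc r) _ ⟩
    ∑ (allFin (suc r)) (λ x → suc r * 𝔼 λ c → 𝟙 (sampled c v) * F (x ∷ c))
      ≡⟨ ∑-cong (allFin (suc r)) (λ x → 𝔼-sampled v (λ c → F (x ∷ c)) λ y c → inv y (x ∷ c)) ⟩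
    ∑ (allFin (suc r)) (λ x → 𝔼 λ c → F (x ∷ c))
      ≡⟨ sym (∑-allVecs-suc (suc r) n F) ⟩
    𝔼 F ∎
    where open ≡-Reasoning

  allSampled-irrelevant : ∀ {n m} {v : Fin n} {xs : Vec (Fin n) m} → Allᵛ (v ≢_) xs →
                          ∀ x c → allSampled {r} xs (c [ v ]≔ x) ≡ allSampled xs c
  allSampled-irrelevant []         x c = refl
  allSampled-irrelevant (v≢y ∷ v∉) x c = cong₂ _*_
    (cong (𝟙 ∘ isZero) (lookup∘update′ (v≢y ∘ sym) c x)) (allSampled-irrelevant v∉ x c)

  mass : ℕ → ℕ
  mass n = 𝔼 {n} λ _ → 1

  mass>0 : ∀ n → 0 < mass n
  mass>0 n = ∑-∈ {xs = colourings n} (λ _ → 1) (∈-allVecs (replicate n zero))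

  𝔼-allSampled : ∀ {n m} {xs : Vec (Fin n) m} → Uniqueᵛ xs → suc r ^ m * 𝔼 (allSampled xs) ≡ mass n
  𝔼-allSampled []             = *-identityˡ _
  𝔼-allSampled {n} {suc m} {x ∷ xs} (x∉xs ∷ u) = begin
    suc r * suc r ^ m * 𝔼 (allSampled (x ∷ xs))   ≡⟨ rearrange (suc r) (suc r ^ m) _ ⟩
    suc r ^ m * (suc r * 𝔼 (allSampled (x ∷ xs))) ≡⟨ cong (suc r ^ m *_) (𝔼-sampled x (allSampled xs) (allSampled-irrelevant x∉xs)) ⟩
    suc r ^ m * 𝔼 (allSampled xs)                 ≡⟨ 𝔼-allSampled u ⟩
    mass n ∎
    where
    open ≡-Reasoning
    rearrange : ∀ q p e → q * p * e ≡ p * (q * e)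
    rearrange = solve-∀

  -- If w is not in `xs`, it costs one more independent factor 1 / `suc r`; if it is, it comes for
  -- free and the bound is `suc r` times larger. Writing the second case with `occurrences` gives
  -- one formula that can be summed over w.
  𝔼-allSampled-extra : ∀ {n m} {xs : Vec (Fin n) m} → Uniqueᵛ xs → ∀ w →
    suc r ^ suc m * 𝔼 (allSampled (w ∷ xs)) ≤ mass n + occurrences w xs * (suc r * mass n)
  𝔼-allSampled-extra {n} {m} {xs} u w with allᵛ? (λ x → ¬? (w ≟ᶠ x)) xs
  ... | yes w∉xs = ≤-trans (≤-reflexive (𝔼-allSampled (w∉xs ∷ u))) (m≤m+n _ _)
  ... | no  w∈xs = begin
    suc r * suc r ^ m * 𝔼 (allSampled (w ∷ xs))
      ≤⟨ *-monoʳ-≤ (suc r ^ suc m) (∑-mono (colourings n) λ c →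
           ≤-trans (*-monoˡ-≤ (allSampled xs c) (𝟙≤1 (sampled c w))) (≤-reflexive (*-identityˡ _))) ⟩
    suc r * suc r ^ m * 𝔼 (allSampled xs)   ≡⟨ trans (*-assoc (suc r) (suc r ^ m) _) (cong (suc r *_) (𝔼-allSampled u)) ⟩
    suc r * mass n                          ≡⟨ sym (*-identityˡ _) ⟩
    1 * (suc r * mass n)                    ≤⟨ *-monoˡ-≤ (suc r * mass n) (occurrences>0 w∈xs) ⟩
    occurrences w xs * (suc r * mass n)     ≤⟨ m≤n+m _ _ ⟩
    mass n + occurrences w xs * (suc r * mass n) ∎
    where open ≤-Reasoning

-- Closed walks, and the subgraph left after deleting short cycles.

unique? : ∀ {n m} (xs : Vec (Fin n) m) → Dec (Uniqueᵛ xs)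
unique? = allPairs? (λ x y → ¬? (x ≟ᶠ y))

-- Here e stands for an edge, b and b′ for its ends being sampled, m and m′ for the numbers of short
-- cycles at the ends. An edge that does not survive has a positive count at one end, and that count
-- pays for it.
kept-or-lost : ∀ b b′ e m m′ →
  𝟙 b * (𝟙 b′ * e) ≤ 𝟙 (b ∧ does (m ≟ 0)) * (𝟙 (b′ ∧ does (m′ ≟ 0)) * e) + (𝟙 b * e * m′ + 𝟙 b′ * e * m)
kept-or-lost false b′    e m m′ = z≤n
kept-or-lost true  false e m m′ = z≤n
kept-or-lost true  true  e zero    zero     = m≤m+n _ _
kept-or-lost true  true  e (suc m) m′       = ≤-trans (m≤m*n (1 * (1 * e)) (suc m))
  (≤-trans (≤-reflexive (cong (_* suc m) (*-identityˡ (1 * e)))) (m≤n+m (1 * e * suc m) (1 * e * m′)))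
kept-or-lost true  true  e zero    (suc m′) = ≤-trans (m≤m*n (1 * (1 * e)) (suc m′))
  (≤-trans (≤-reflexive (cong (_* suc m′) (*-identityˡ (1 * e)))) (m≤m+n (1 * e * suc m′) (1 * e * 0)))

module _ (G : Graph) where

  private
    V = allFin (n G)
    a : Fin (n G) → Fin (n G) → ℕ
    a u v = 𝟙 (adj G u v)

  opaque
    unfolding ∑
    deg≡∑ : ∀ v → deg G v ≡ ∑ V (a v)
    deg≡∑ v = refl

    degSum≡∑ : degSum G ≡ ∑ V λ u → ∑ V (a u)
    degSum≡∑ = refl

  adj-distinct : ∀ {u v} → adj G u v ≡ true → u ≢ v
  adj-distinct {u} e refl with trans (sym e) (irrefl G u)
  ... | ()

  -- The indicator that u, followed by `xs`, followed by z is a walk. The endpoint z is separate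
  -- from the start so that an induction can move the start alone.
  closing : ∀ {m} → Fin (n G) → Fin (n G) → Vec (Fin (n G)) m → ℕ
  closing z u []       = a u z
  closing z u (x ∷ xs) = a u x * closing z x xs

  closing-walk : ∀ {m} z (p : Fin (suc m) → Fin (n G)) →
    (∀ (i : Fin m) → Adj G (p (inject₁ i)) (p (suc i))) → Adj G (p (fromℕ m)) z →
    closing z (p zero) (tabulate (p ∘ suc)) ≡ 1
  closing-walk {zero}  z p step last = cong 𝟙 last
  closing-walk {suc m} z p step last = cong₂ _*_ (cong 𝟙 (step zero)) (closing-walk z (p ∘ suc) (step ∘ suc) last)

  closedWalks : ℕ → Fin (n G) → Fin (n G) → ℕ
  closedWalks j z u = ∑ (allVecs (n G) (2 + j)) (closing z u)

  module _ {D M : ℕ} (deg≤D : ∀ v → ∑ V (a v) ≤ D) where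

    -- Each further first step has at most D choices, and the saving M comes from the last three
    -- edges. The start moves during the induction, which is why u and z range independently.
    closedWalks-bound : (∀ u z → M * closedWalks 0 z u ≤ D * D) →
                        ∀ j z u → M * closedWalks j z u ≤ D ^ j * (D * D)
    closedWalks-bound base zero    z u = ≤-trans (base u z) (≤-reflexive (sym (*-identityˡ _)))
    closedWalks-bound base (suc j) z u = begin
      M * closedWalks (suc j) z u
        ≡⟨ cong (M *_) (trans (∑-allVecs-suc (n G) (2 + j) _)
             (∑-cong V λ x → sym (*-distribˡ-∑ (allVecs (n G) (2 + j)) (a u x) _))) ⟩
      M * ∑ V (λ x → a u x * closedWalks j z x)
        ≡⟨ trans (*-distribˡ-∑ V M _) (∑-cong V λ x → swap M (a u x) _) ⟩
      ∑ V (λ x → a u x * (M * closedWalks j z x))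
        ≤⟨ ∑-mono V (λ x → *-monoʳ-≤ (a u x) (closedWalks-bound base j z x)) ⟩
      ∑ V (λ x → a u x * (D ^ j * (D * D)))  ≡⟨ sym (*-distribʳ-∑ V _ _) ⟩
      ∑ V (a u) * (D ^ j * (D * D))          ≤⟨ *-monoˡ-≤ (D ^ j * (D * D)) (deg≤D u) ⟩
      D * (D ^ j * (D * D))                  ≡⟨ sym (*-assoc D (D ^ j) _) ⟩
      D ^ suc j * (D * D) ∎
      where
      open ≤-Reasoning
      swap : ∀ m b w → m * (b * w) ≡ b * (m * w)
      swap = solve-∀

    -- A walk of length three from u to z is an edge from a neighbour of u to a neighbour of z. Too
    -- many of them make the two neighbourhoods a dense pair. The neighbourhoods may overlap, but
    -- the sides of the biclique cannot, as a graph has no loops.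
    few-closedWalks : ∀ t .{{_ : NonZero M}} .{{_ : NonZero t}} → 2 * M * (4 * M * t) ≤ D →
      4 * M * ((4 * M * t) ^ t * t) < D → HasKtt t G ⊎ (∀ u z → M * closedWalks 0 z u ≤ D * D)
    few-closedWalks t D≥₁ D≥₂ with any? (λ u → any? λ z → D * D <? M * closedWalks 0 z u)
    ... | no  sparse = inj₂ λ u z → ≮⇒≥ λ dense → sparse (u , z , dense)
    ... | yes (u , z , dense) = inj₁ (proj₁ K , proj₁ (proj₂ K) , proj₁ (proj₂ (proj₂ K)) , proj₁ (proj₂ (proj₂ (proj₂ K)))
                                     , (λ i j → adj-distinct (all-adj i j)) , all-adj)
      where
      open KővariSósTurán (adj G) (adj G u) (adj G z) t M D (deg≤D u) (deg≤D z)
        using (edges; biclique)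
      walks-edges : closedWalks 0 z u ≡ edges
      walks-edges = begin
        closedWalks 0 z u
          ≡⟨ trans (∑-allVecs-suc (n G) 1 _) (∑-cong V λ x → ∑-allVecs-suc (n G) 0 _) ⟩
        ∑ V (λ x → ∑ V λ y → ∑ (allVecs (n G) 0) λ xs → closing z u (x ∷ y ∷ xs))
          ≡⟨ ∑-cong V (λ x → ∑-cong V λ y → trans (∑-cong (allVecs (n G) 0) λ { [] → refl })
               (trans (∑-const (allVecs (n G) 0) _) (*-identityˡ (a u x * (a x y * a y z))))) ⟩
        ∑ V (λ x → ∑ V λ y → a u x * (a x y * a y z))  ≡⟨ ∑-comm V V _ ⟩
        ∑ V (λ y → ∑ V λ x → a u x * (a x y * a y z))
          ≡⟨ ∑-cong V (λ y → trans (∑-cong V λ x → trans (sym (*-assoc (a u x) (a x y) (a y z)))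
               (cong (λ e → a u x * a x y * 𝟙 e) (Graph.sym G y z))) (sym (*-distribʳ-∑ V (a z y) _))) ⟩
        edges ∎
        where open ≡-Reasoning
      K = biclique D≥₁ D≥₂ (subst (λ e → D * D < M * e) walks-edges dense)
      all-adj : ∀ i j → Adj G (proj₁ K i) (proj₁ (proj₂ K) j)
      all-adj = proj₂ (proj₂ (proj₂ (proj₂ K)))

  module _ {r : ℕ} (c : Colouring r (n G)) where

    size : ℕ
    size = ∑ V λ v → 𝟙 (sampled c v)

    inner : ℕ
    inner = ∑ V λ u → ∑ V λ v → 𝟙 (sampled c u) * (𝟙 (sampled c v) * a u v)

    sampledDeg : Fin (n G) → ℕ
    sampledDeg z = ∑ V λ w → 𝟙 (sampled c w) * a z w

    -- Only walks without repeated vertices are counted: a degenerate closed walk, such as one going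
    -- back and forth, has fewer vertices and would be sampled with too large a probability.
    cyclesFrom : ℕ → Fin (n G) → ℕ
    cyclesFrom j z = ∑ (allVecs (n G) (2 + j)) λ xs →
      closing z z xs * 𝟙 (does (unique? (z ∷ xs))) * allSampled (z ∷ xs) c

    module _ (k : ℕ) where

      shortCycles : Fin (n G) → ℕ
      shortCycles z = ∑ (upTo k) λ j → cyclesFrom j z

      -- An overcount of the sampled edges at deleted vertices, weighted by the number of cycles.
      -- This makes it a sum of products of sampling indicators, whose expectation can be bounded
      -- termwise.
      lost : ℕ
      lost = ∑ V λ z → sampledDeg z * shortCycles z

      kept : Fin (n G) → Bool
      kept v = sampled c v ∧ does (shortCycles v ≟ 0)

      keptCount : ℕ
      keptCount = length (members kept)

      keptVertex : Fin keptCount → Fin (n G)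
      keptVertex = lookup (members kept)

      keptGraph : Graph
      keptGraph = induced G keptCount keptVertex

      keptCount≤size : keptCount ≤ size
      keptCount≤size = ≤-trans (≤-reflexive (length-members kept)) (∑-mono V λ v → ≤-trans (≤-reflexive (𝟙-∧ (sampled c v) _))
        (≤-trans (*-monoʳ-≤ (𝟙 (sampled c v)) (𝟙≤1 (does (shortCycles v ≟ 0)))) (≤-reflexive (*-identityʳ _))))

      inner-kept : ℕ
      inner-kept = ∑ V λ u → ∑ V λ v → 𝟙 (kept u) * (𝟙 (kept v) * a u v)

      ∑∑-kept : ∑ (allFin keptCount) (λ i → ∑ (allFin keptCount) λ j → a (keptVertex i) (keptVertex j)) ≡ inner-kept
      ∑∑-kept = trans (∑-cong (allFin keptCount) λ i → ∑-members kept (a (keptVertex i)))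
        (trans (∑-members kept (λ u → ∑ V λ v → 𝟙 (kept v) * a u v))
               (∑-cong V λ u → *-distribˡ-∑ V (𝟙 (kept u)) _))

      inner≤ : inner ≤ inner-kept + 2 * lost
      inner≤ = begin
        inner  ≤⟨ ∑-mono V (λ u → ∑-mono V λ v →
                    kept-or-lost (sampled c u) (sampled c v) (a u v) (shortCycles u) (shortCycles v)) ⟩
        ∑ V (λ u → ∑ V λ v → 𝟙 (kept u) * (𝟙 (kept v) * a u v) + (lost₁ u v + lost₂ u v))
          ≡⟨ trans (∑-cong V λ u → trans (∑-distrib-+ V _ _) (cong (∑ V (λ v → 𝟙 (kept u) * (𝟙 (kept v) * a u v)) +_) (∑-distrib-+ V _ _)))
               (trans (∑-distrib-+ V _ _) (cong (inner-kept +_) (∑-distrib-+ V _ _))) ⟩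
        inner-kept + (∑ V (λ u → ∑ V (lost₁ u)) + ∑ V (λ u → ∑ V (lost₂ u)))
          ≡⟨ cong (inner-kept +_) (cong₂ _+_
               (trans (∑-comm V V lost₁) (∑-cong V λ v → trans (∑-cong V λ u →
                 cong (λ b → 𝟙 (sampled c u) * 𝟙 b * shortCycles v) (Graph.sym G u v)) (sym (*-distribʳ-∑ V _ _))))
               (trans (∑-cong V λ u → sym (*-distribʳ-∑ V _ _)) (sym (+-identityʳ lost)))) ⟩
        inner-kept + 2 * lost ∎
        where
        open ≤-Reasoning
        lost₁ lost₂ : Fin (n G) → Fin (n G) → ℕ
        lost₁ u v = 𝟙 (sampled c u) * a u v * shortCycles v
        lost₂ u v = 𝟙 (sampled c v) * a u v * shortCycles u

      -- A cycle of length below k on kept vertices is a sampled cycle of G, hence is counted at its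
      -- own first vertex, where being kept demands the count 0.
      girth : Girth≥ keptGraph k
      girth j (v , v-inj , step , last) = ≮⇒≥ λ 3+j<k → 1+n≢0 (shorts 3+j<k)
        where
        p = keptVertex ∘ v
        xs = tabulate (p ∘ suc)
        good : ∀ i → sampled c (p i) ≡ true × does (shortCycles (p i) ≟ 0) ≡ true
        good i = ∧-true (members-satisfy kept (v i))
        p-inj : Injective _≡_ _≡_ p
        p-inj = v-inj ∘ members-injective kept
        counted : closing (p zero) (p zero) xs * 𝟙 (does (unique? (tabulate p))) * allSampled (tabulate p) c ≡ 1
        counted = cong₂ _*_ (cong₂ _*_ (closing-walk (p zero) p step last)
          (cong 𝟙 (dec-true (unique? (tabulate p)) (tabulate⁺ p-inj)))) (allSampled-all c p (proj₁ ∘ good))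
        shorts : 3 + j < k → 1 ≡ 0
        shorts 3+j<k = ≤-antisym (begin
          1  ≡⟨ sym counted ⟩
          _  ≤⟨ ∑-∈ {xs = allVecs (n G) (2 + j)} _ (∈-allVecs xs) ⟩
          cyclesFrom j (p zero)  ≤⟨ ∑-∈ _ (∈-upTo⁺ (≤-trans (s≤s (m≤n+m j 3)) 3+j<k)) ⟩
          shortCycles (p zero)   ≡⟨ does-true (_ ≟ 0) (proj₂ (good zero)) ⟩
          0 ∎) z≤n
          where open ≤-Reasoning

-- Expected size, edges and loss of the sample.

cycleWeight : ℕ → ℕ → ℕ
cycleWeight H j = H ^ (2 + j) * (H + (3 + j))

^-distribʳ-* : ∀ k a b → (a * b) ^ k ≡ a ^ k * b ^ k
^-distribʳ-* zero    a b = refl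
^-distribʳ-* (suc k) a b = trans (cong (a * b *_) (^-distribʳ-* k a b)) (interchange a b (a ^ k) (b ^ k))
  where
  interchange : ∀ a b x y → a * b * (x * y) ≡ a * x * (b * y)
  interchange = solve-∀

module _ (G : Graph) (r : ℕ) where

  private
    V = allFin (n G)
    a : Fin (n G) → Fin (n G) → ℕ
    a u v = 𝟙 (adj G u v)
    q = suc r
    W = mass r (n G)
    cs = colourings r (n G)

  𝔼-size : q * 𝔼 r (size G) ≡ n G * W
  𝔼-size = begin
    q * 𝔼 r (size G)  ≡⟨ cong (q *_) (∑-comm cs V _) ⟩
    q * ∑ V (λ v → 𝔼 r λ c → 𝟙 (sampled c v))  ≡⟨ *-distribˡ-∑ V q _ ⟩
    ∑ V (λ v → q * 𝔼 r λ c → 𝟙 (sampled c v))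
      ≡⟨ ∑-cong V (λ v → trans (cong (q *_) (∑-cong cs λ c → sym (*-identityʳ _)))
           (𝔼-sampled r v (λ _ → 1) λ _ _ → refl)) ⟩
    ∑ V (λ _ → W)  ≡⟨ ∑-allFin-const (n G) W ⟩
    n G * W ∎
    where open ≡-Reasoning

  𝔼-edge : ∀ u v → q * q * 𝔼 r (λ c → 𝟙 (sampled c u) * (𝟙 (sampled c v) * a u v)) ≡ a u v * W
  𝔼-edge u v with adj G u v in uv
  ... | false = trans (cong (q * q *_) (trans (∑-cong cs λ c → trans (cong (𝟙 (sampled c u) *_) (*-zeroʳ (𝟙 (sampled c v))))
                  (*-zeroʳ (𝟙 (sampled c u)))) (trans (∑-const cs 0) (*-zeroʳ (length cs))))) (*-zeroʳ (q * q))
  ... | true  = trans (cong (λ p → q * p * 𝔼 r (allSampled (u ∷ v ∷ []))) (sym (*-identityʳ q)))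
                  (trans (𝔼-allSampled r {xs = u ∷ v ∷ []} ((adj-distinct G uv ∷ []) ∷ [] ∷ [])) (sym (*-identityˡ W)))

  𝔼-inner : q * q * 𝔼 r (inner G) ≡ degSum G * W
  𝔼-inner = begin
    q * q * 𝔼 r (inner G)
      ≡⟨ cong (q * q *_) (trans (∑-comm cs V _) (∑-cong V λ u → ∑-comm cs V _)) ⟩
    q * q * ∑ V (λ u → ∑ V λ v → 𝔼 r λ c → 𝟙 (sampled c u) * (𝟙 (sampled c v) * a u v))
      ≡⟨ trans (*-distribˡ-∑ V (q * q) _) (∑-cong V λ u → *-distribˡ-∑ V (q * q) _) ⟩
    ∑ V (λ u → ∑ V λ v → q * q * 𝔼 r λ c → 𝟙 (sampled c u) * (𝟙 (sampled c v) * a u v))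
      ≡⟨ ∑-cong V (λ u → trans (∑-cong V (𝔼-edge u)) (sym (*-distribʳ-∑ V W _))) ⟩
    ∑ V (λ u → ∑ V (a u) * W)  ≡⟨ sym (*-distribʳ-∑ V W _) ⟩
    (∑ V λ u → ∑ V (a u)) * W  ≡⟨ cong (_* W) (sym (degSum≡∑ G)) ⟩
    degSum G * W ∎
    where open ≡-Reasoning

  module _ {D : ℕ} (deg≤D : ∀ v → ∑ V (a v) ≤ D) where

    -- At most D neighbours of z contribute W each, as if independent of `ys`; the m entries of `ys`
    -- may contribute q times as much.
    𝔼-sampledDeg : ∀ {m} z {ys : Vec (Fin (n G)) m} → Uniqueᵛ ys →
      q ^ suc m * 𝔼 r (λ c → sampledDeg G c z * allSampled ys c) ≤ W * (D + m * q)
    𝔼-sampledDeg {m} z {ys} u = begin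
      q ^ suc m * 𝔼 r (λ c → sampledDeg G c z * allSampled ys c)
        ≡⟨ cong (q ^ suc m *_) (trans (∑-cong cs λ c → trans (*-distribʳ-∑ V (allSampled ys c) _)
             (∑-cong V λ w → pull (𝟙 (sampled c w)) (a z w) (allSampled ys c))) (∑-comm cs V _)) ⟩
      q ^ suc m * ∑ V (λ w → 𝔼 r λ c → a z w * allSampled (w ∷ ys) c)
        ≡⟨ trans (*-distribˡ-∑ V (q ^ suc m) _) (∑-cong V λ w → trans (cong (q ^ suc m *_) (sym (*-distribˡ-∑ cs (a z w) _)))
             (swap (q ^ suc m) (a z w) _)) ⟩
      ∑ V (λ w → a z w * (q ^ suc m * 𝔼 r (allSampled (w ∷ ys))))
        ≤⟨ ∑-mono V (λ w → ≤-trans (*-monoʳ-≤ (a z w) (𝔼-allSampled-extra r u w)) (split (adj G z w) W _)) ⟩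
      ∑ V (λ w → a z w * W + occurrences w ys * (q * W))
        ≡⟨ trans (∑-distrib-+ V _ _) (sym (cong₂ _+_ (*-distribʳ-∑ V W _) (*-distribʳ-∑ V (q * W) _))) ⟩
      ∑ V (a z) * W + ∑ V (λ w → occurrences w ys) * (q * W)
        ≤⟨ +-mono-≤ (*-monoˡ-≤ W (deg≤D z)) (≤-reflexive (cong (_* (q * W)) (∑-occurrences ys))) ⟩
      D * W + m * (q * W)  ≡⟨ collect D W m q ⟩
      W * (D + m * q) ∎
      where
      open ≤-Reasoning
      pull : ∀ s e y → s * e * y ≡ e * (s * y)
      pull = solve-∀
      swap : ∀ p e y → p * (e * y) ≡ e * (p * y)
      swap = solve-∀
      collect : ∀ D W m q → D * W + m * (q * W) ≡ W * (D + m * q)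
      collect = solve-∀
      split : ∀ b x y → 𝟙 b * (x + y) ≤ 𝟙 b * x + y
      split true  x y = ≤-reflexive (trans (*-identityˡ (x + y)) (cong (_+ y) (sym (*-identityˡ x))))
      split false x y = z≤n

    𝔼-cycle : ∀ {m} z (xs : Vec (Fin (n G)) m) (u? : Dec (Uniqueᵛ (z ∷ xs))) →
      q ^ (2 + m) * 𝔼 r (λ c → sampledDeg G c z * (closing G z z xs * 𝟙 (does u?) * allSampled (z ∷ xs) c))
        ≤ closing G z z xs * (W * (D + suc m * q))
    𝔼-cycle {m} z xs (no _) = ≤-trans (≤-reflexive (trans (cong (q ^ (2 + m) *_) (trans (∑-cong cs λ c →
                    vanish (sampledDeg G c z) (closing G z z xs) (allSampled (z ∷ xs) c)) (trans (∑-const cs 0) (*-zeroʳ (length cs)))))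
                    (*-zeroʳ (q ^ (2 + m))))) z≤n
      where
      vanish : ∀ s l y → s * (l * 0 * y) ≡ 0
      vanish = solve-∀
    𝔼-cycle {m} z xs (yes u) = begin
      q ^ (2 + m) * 𝔼 r (λ c → sampledDeg G c z * (l * 1 * allSampled (z ∷ xs) c))
        ≡⟨ cong (q ^ (2 + m) *_) (trans (∑-cong cs λ c → pull (sampledDeg G c z) l (allSampled (z ∷ xs) c)) (sym (*-distribˡ-∑ cs l _))) ⟩
      q ^ (2 + m) * (l * 𝔼 r (λ c → sampledDeg G c z * allSampled (z ∷ xs) c))
        ≡⟨ swap (q ^ (2 + m)) l _ ⟩
      l * (q ^ (2 + m) * 𝔼 r (λ c → sampledDeg G c z * allSampled (z ∷ xs) c))
        ≤⟨ *-monoʳ-≤ l (𝔼-sampledDeg z u) ⟩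
      l * (W * (D + suc m * q)) ∎
      where
      open ≤-Reasoning
      l = closing G z z xs
      pull : ∀ s l y → s * (l * 1 * y) ≡ l * (s * y)
      pull = solve-∀
      swap : ∀ p e y → p * (e * y) ≡ e * (p * y)
      swap = solve-∀

    module _ {M H : ℕ} (D≤Hq : D ≤ H * q) (sparse : ∀ u z → M * closedWalks G 0 z u ≤ D * D) where

      -- At most D^(2+j) / M closed walks start at z, each contributing at most W (D + (3+j) q) /
      -- q^(4+j); the exponent counts the 3 + j vertices of the cycle and one neighbour of z. With D
      -- ≤ H q, all powers of D and q cancel and `cycleWeight H j` remains.
      𝔼-cyclesFrom : ∀ j z →
        M * (q * 𝔼 r (λ c → sampledDeg G c z * cyclesFrom G c j z)) ≤ cycleWeight H j * W
      𝔼-cyclesFrom j z = *-cancelˡ-≤ (q ^ (3 + j)) {{m^n≢0 q (3 + j)}} (begin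
        q ^ (3 + j) * (M * (q * X))  ≡⟨ regroup (q ^ (3 + j)) M q X ⟩
        M * (q ^ (4 + j) * X)        ≤⟨ *-monoʳ-≤ M bound ⟩
        M * (closedWalks G j z z * Y)  ≡⟨ sym (*-assoc M _ Y) ⟩
        M * closedWalks G j z z * Y  ≤⟨ *-monoˡ-≤ Y (closedWalks-bound G {M = M} deg≤D sparse j z z) ⟩
        D ^ j * (D * D) * (W * (D + (3 + j) * q))
          ≤⟨ *-mono-≤ (*-mono-≤ (^-monoˡ-≤ j D≤Hq) (*-mono-≤ D≤Hq D≤Hq)) (*-monoʳ-≤ W (+-monoˡ-≤ ((3 + j) * q) D≤Hq)) ⟩
        (H * q) ^ j * (H * q * (H * q)) * (W * (H * q + (3 + j) * q))
          ≡⟨ cong (λ p → p * (H * q * (H * q)) * (W * (H * q + (3 + j) * q))) (^-distribʳ-* j H q) ⟩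
        H ^ j * q ^ j * (H * q * (H * q)) * (W * (H * q + (3 + j) * q))
          ≡⟨ collect (H ^ j) (q ^ j) H q W (3 + j) ⟩
        q ^ (3 + j) * (cycleWeight H j * W) ∎)
        where
        open ≤-Reasoning
        X = 𝔼 r (λ c → sampledDeg G c z * cyclesFrom G c j z)
        Y = W * (D + (3 + j) * q)
        L = allVecs (n G) (2 + j)
        regroup : ∀ p M q x → p * (M * (q * x)) ≡ M * (q * p * x)
        regroup = solve-∀
        collect : ∀ h p H q W s → h * p * (H * q * (H * q)) * (W * (H * q + s * q))
                  ≡ q * (q * (q * p)) * (H * (H * h) * (H + s) * W)
        collect = solve-∀
        bound : q ^ (4 + j) * X ≤ closedWalks G j z z * Y
        bound = begin
          q ^ (4 + j) * X
            ≡⟨ cong (q ^ (4 + j) *_) (trans (∑-cong cs λ c → *-distribˡ-∑ L (sampledDeg G c z) _) (∑-comm cs L _)) ⟩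
          q ^ (4 + j) * ∑ L (λ xs → 𝔼 r λ c → sampledDeg G c z *
            (closing G z z xs * 𝟙 (does (unique? (z ∷ xs))) * allSampled (z ∷ xs) c))
            ≡⟨ *-distribˡ-∑ L (q ^ (4 + j)) _ ⟩
          _ ≤⟨ ∑-mono L (λ xs → 𝔼-cycle z xs (unique? (z ∷ xs))) ⟩
          ∑ L (λ xs → closing G z z xs * Y)  ≡⟨ sym (*-distribʳ-∑ L Y _) ⟩
          closedWalks G j z z * Y ∎

      𝔼-lost : ∀ k → M * (q * 𝔼 r (λ c → lost G c k)) ≤ n G * (∑ (upTo k) (cycleWeight H) * W)
      𝔼-lost k = begin
        M * (q * 𝔼 r (λ c → lost G c k))
          ≡⟨ cong (λ x → M * (q * x)) (trans (∑-comm cs V _) (∑-cong V λ z →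
               trans (∑-cong cs λ c → *-distribˡ-∑ (upTo k) (sampledDeg G c z) _) (∑-comm cs (upTo k) _))) ⟩
        M * (q * ∑ V (λ z → ∑ (upTo k) λ j → X j z))
          ≡⟨ trans (sym (*-assoc M q _)) (trans (*-distribˡ-∑ V (M * q) _) (∑-cong V λ z → *-distribˡ-∑ (upTo k) (M * q) _)) ⟩
        ∑ V (λ z → ∑ (upTo k) λ j → M * q * X j z)
          ≤⟨ ∑-mono V (λ z → ∑-mono (upTo k) λ j → ≤-trans (≤-reflexive (*-assoc M q _)) (𝔼-cyclesFrom j z)) ⟩
        ∑ V (λ z → ∑ (upTo k) λ j → cycleWeight H j * W)
          ≡⟨ trans (∑-cong V λ z → sym (*-distribʳ-∑ (upTo k) W _)) (∑-allFin-const (n G) _) ⟩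
        n G * (∑ (upTo k) (cycleWeight H) * W) ∎
        where
        open ≤-Reasoning
        X : ℕ → Fin (n G) → ℕ
        X j z = 𝔼 r (λ c → sampledDeg G c z * cyclesFrom G c j z)

-- Choice of parameters and conclusion.

DenseInducedOfGirth≥ : Graph → ℕ → ℕ → Set
DenseInducedOfGirth≥ G t k = Σ ℕ λ m → Σ (Fin m → Fin (n G)) λ e → Injective _≡_ _≡_ e × 0 < m ×
  AvgDeg≥ (induced G m e) t × Girth≥ (induced G m e) k

-- S, L and I are the total size, loss and degree sum over all colourings. In units of n W / q, S is
-- exactly 1, I is at least 2 + t and 2L is at most 1, so one unit is left over.
expected-surplus : ∀ {t l q n D W C d S L I} → .{{NonZero q}} → 0 < n → 0 < W →
  suc l * (2 + t) * q ≤ D → n * D ≤ suc l * d →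
  q * S ≡ n * W → q * q * I ≡ d * W → 2 * suc C * (q * L) ≤ n * (C * W) →
  2 * L + t * S < I
expected-surplus {t} {l} {q} {n} {D} {W} {C} {d} {S} {L} {I} n>0 W>0 Kq≤D nD≤ld S≡ I≡ L≤ =
  *-cancelˡ-< q _ _ (begin-strict
    q * (2 * L + t * S)        ≡⟨ expand q L t S ⟩
    2 * (q * L) + t * (q * S)  ≡⟨ cong (λ s → 2 * (q * L) + t * s) S≡ ⟩
    2 * (q * L) + t * (n * W)  ≤⟨ +-monoˡ-≤ (t * (n * W)) 2qL≤nW ⟩
    suc t * (n * W)            <⟨ m<n+m (suc t * (n * W)) (*-mono-≤ n>0 W>0) ⟩
    (2 + t) * (n * W)          ≤⟨ many-edges ⟩
    q * I ∎)
  where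
  open ≤-Reasoning
  expand : ∀ q L t S → q * (2 * L + t * S) ≡ 2 * (q * L) + t * (q * S)
  expand = solve-∀
  2qL≤nW : 2 * (q * L) ≤ n * W
  2qL≤nW = *-cancelˡ-≤ (suc C) (begin
    suc C * (2 * (q * L))  ≡⟨ shift (suc C) (q * L) ⟩
    2 * suc C * (q * L)    ≤⟨ L≤ ⟩
    n * (C * W)            ≡⟨ swap n C W ⟩
    C * (n * W)            ≤⟨ *-monoˡ-≤ (n * W) (n≤1+n C) ⟩
    suc C * (n * W) ∎)
    where
    shift : ∀ c x → c * (2 * x) ≡ 2 * c * x
    shift = solve-∀
    swap : ∀ n c w → n * (c * w) ≡ c * (n * w)
    swap = solve-∀
  many-edges : (2 + t) * (n * W) ≤ q * I
  many-edges = *-cancelˡ-≤ (suc l * q) {{m*n≢0 (suc l) q}} (begin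
    suc l * q * ((2 + t) * (n * W))  ≡⟨ gather (suc l) q (2 + t) n W ⟩
    n * (suc l * (2 + t) * q) * W    ≤⟨ *-monoˡ-≤ W (*-monoʳ-≤ n Kq≤D) ⟩
    n * D * W                        ≤⟨ *-monoˡ-≤ W nD≤ld ⟩
    suc l * d * W                    ≡⟨ *-assoc (suc l) d W ⟩
    suc l * (d * W)                  ≡⟨ cong (suc l *_) (sym I≡) ⟩
    suc l * (q * q * I)              ≡⟨ ungather (suc l) q I ⟩
    suc l * q * (q * I) ∎)
    where
    gather : ∀ l q t n W → l * q * (t * (n * W)) ≡ n * (l * t * q) * W
    gather = solve-∀
    ungather : ∀ l q I → l * (q * q * I) ≡ l * q * (q * I)
    ungather = solve-∀

surplus⇒dense : ∀ {r} (G : Graph) t k (c : Colouring r (n G)) →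
  2 * lost G c k + t * size G c < inner G c → DenseInducedOfGirth≥ G t k
surplus⇒dense G t k c surplus = keptCount G c k , keptVertex G c k , members-injective (kept G c k) , nonempty , <⇒≤ dense , girth G c k
  where
  open ≤-Reasoning
  degSum≡ : degSum (keptGraph G c k) ≡ inner-kept G c k
  degSum≡ = trans (degSum≡∑ (keptGraph G c k)) (∑∑-kept G c k)
  dense : t * keptCount G c k < degSum (keptGraph G c k)
  dense = +-cancelˡ-< (2 * lost G c k) _ _ (begin-strict
    2 * lost G c k + t * keptCount G c k       ≤⟨ +-monoʳ-≤ _ (*-monoʳ-≤ t (keptCount≤size G c k)) ⟩
    2 * lost G c k + t * size G c      <⟨ surplus ⟩
    inner G c                          ≤⟨ inner≤ G c k ⟩
    inner-kept G c k + 2 * lost G c k  ≡⟨ trans (+-comm _ (2 * lost G c k)) (cong (2 * lost G c k +_) (sym degSum≡)) ⟩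
    2 * lost G c k + degSum (keptGraph G c k) ∎)
  -- The strict inequality matters here: an empty kept set would turn it into 0 < 0.
  nonempty : 0 < keptCount G c k
  nonempty = n≢0⇒n>0 λ m≡0 → n≮0 (subst (t * keptCount G c k <_) (empty m≡0) dense)
    where
    empty : keptCount G c k ≡ 0 → degSum (keptGraph G c k) ≡ 0
    empty m≡0 = trans (degSum≡∑ (keptGraph G c k)) (vacuous (keptCount G c k) m≡0 _)
      where
      vacuous : ∀ m → m ≡ 0 → (f : Fin m → ℕ) → ∑ (allFin m) f ≡ 0
      vacuous zero refl f = trans (∑-cong [] {f} {λ _ → 0} λ ()) (∑-const {A = Fin 0} [] 0)

-- K is D times the sampling probability, up to a factor 2. Missing the trivial bound D² on
-- N(u)–N(z) edges by a factor M makes the expected loss of edges at short cycles at most half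
-- the expected number of sampled vertices.
module Parameters (t k λ′ : ℕ) where

  K weight M threshold-degree : ℕ
  K = λ′ * (2 + t)
  weight = ∑ (upTo k) (cycleWeight (2 * K))
  M = 2 * suc weight
  threshold-degree = K + (2 * M * (4 * M * t) + suc (4 * M * ((4 * M * t) ^ t * t)))

-- `suc r` is D / K rounded down, at least 1 because K ≤ D. The remainder is below K, hence at most
-- K * `suc r`, which costs the factor 2.
rounded-quotient : ∀ K D .{{_ : NonZero K}} → K ≤ D →
  ∃ λ r → K * suc r ≤ D × D ≤ 2 * K * suc r
rounded-quotient K D K≤D with D / K | m≥n⇒m/n>0 K≤D | m/n*n≤m D K | m≡m%n+[m/n]*n D K
... | suc r | _ | qK≤D | D≡ = r , ≤-trans (≤-reflexive (*-comm K (suc r))) qK≤D , (begin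
  D                        ≡⟨ D≡ ⟩
  D % K + suc r * K        ≤⟨ +-monoˡ-≤ (suc r * K) (<⇒≤ (m%n<n D K)) ⟩
  K + suc r * K            ≤⟨ +-monoˡ-≤ (suc r * K) (m≤n*m K (suc r)) ⟩
  suc r * K + suc r * K    ≡⟨ double (suc r) K ⟩
  2 * K * suc r ∎)
  where
  open ≤-Reasoning
  double : ∀ q K → q * K + q * K ≡ 2 * K * q
  double = solve-∀

module _ (G : Graph) (n>0 : 0 < n G) (t k l : ℕ) .{{_ : NonZero t}} where
  open Parameters t k (suc l)

  -- The threshold adds up three lower bounds on D: K, so that D / K rounds to a positive integer,
  -- and the two size conditions of the biclique argument, with a `suc` for the strict one.
  large-degree⇒ : ∀ D → threshold-degree ≤ D → (∀ v → deg G v ≤ D) → n G * D ≤ suc l * degSum G →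
                  HasKtt t G ⊎ DenseInducedOfGirth≥ G t k
  large-degree⇒ D D≥ deg≤D nD≤ = map₂ sample (few-closedWalks G {M = M} deg≤D′ t
      (≤-trans (m≤m+n _ _) (m+n≤o⇒n≤o K D≥)) (m+n≤o⇒n≤o (2 * M * (4 * M * t)) (m+n≤o⇒n≤o K D≥)))
    where
    deg≤D′ : ∀ v → ∑ (allFin (n G)) (𝟙 ∘ adj G v) ≤ D
    deg≤D′ v = subst (_≤ D) (deg≡∑ G v) (deg≤D v)
    rounded = rounded-quotient K D (m+n≤o⇒m≤o K D≥)
    r = proj₁ rounded
    sample : (∀ u z → M * closedWalks G 0 z u ≤ D * D) → DenseInducedOfGirth≥ G t k
    sample sparse = surplus⇒dense G t k (proj₁ best) (proj₂ best)
      where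
      surplus : 𝔼 r (λ c → 2 * lost G c k + t * size G c) < 𝔼 r (inner G)
      surplus = subst (_< 𝔼 r (inner G))
        (sym (trans (∑-distrib-+ (colourings r (n G)) _ _) (sym (cong₂ _+_ (*-distribˡ-∑ (colourings r (n G)) 2 _) (*-distribˡ-∑ (colourings r (n G)) t _)))))
        (expected-surplus {t = t} {l = l} {C = weight} {d = degSum G} n>0 (mass>0 r (n G)) (proj₁ (proj₂ rounded)) nD≤
          (𝔼-size G r) (𝔼-inner G r)
          (𝔼-lost G r deg≤D′ {M} {2 * K} (proj₂ (proj₂ rounded)) sparse k))
      best = ∑-<⇒∃ (colourings r (n G)) _ _ surplus

theorem1p2 : Σ (ℕ → ℕ → ℕ → ℕ) λ f → ∀ (t k λ' : ℕ) (G : Graph) →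
    0 < n G → Bipartite G → AvgDeg≥ G (f t k λ') → MaxDeg≤λAvg G λ' →
    HasKtt t G ⊎
    Σ ℕ λ m → Σ (Fin m → Fin (n G)) λ e → Injective _≡_ _≡_ e × 0 < m ×
    AvgDeg≥ (induced G m e) t × Girth≥ (induced G m e) k
theorem1p2 = Parameters.threshold-degree , main
  where
  main : ∀ (t k λ' : ℕ) (G : Graph) → 0 < n G → Bipartite G →
    AvgDeg≥ G (Parameters.threshold-degree t k λ') → MaxDeg≤λAvg G λ' →
    HasKtt t G ⊎ DenseInducedOfGirth≥ G t k
  -- The empty biclique lies in every graph.
  main zero k λ' G n>0 _ avg max = inj₁ ((λ ()) , (λ ()) , (λ {}) , (λ {}) , (λ ()) , λ ())
  -- For λ = 0 all vertices are isolated, whereas the threshold is positive through its `suc`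
  -- summand even though K is 0.
  main (suc t) k zero G n>0 _ avg max = contradiction avg (<⇒≱ (begin-strict
    degSum G                             ≡⟨ degSum≡∑ G ⟩
    ∑ (allFin (n G)) (λ u → ∑ (allFin (n G)) (𝟙 ∘ adj G u))
      ≤⟨ ∑-mono (allFin (n G)) (λ u → ≤-reflexive (trans (sym (deg≡∑ G u)) (isolated u))) ⟩
    ∑ (allFin (n G)) (λ _ → 0)           ≡⟨ trans (∑-const (allFin (n G)) 0) (*-zeroʳ (length (allFin (n G)))) ⟩
    0                                    <⟨ *-mono-≤ (≤-trans (s≤s z≤n) (m≤n+m _ (2 * M * (4 * M * suc t)))) n>0 ⟩
    threshold-degree * n G ∎))
    where
    open Parameters (suc t) k zero
    open ≤-Reasoning
    isolated : ∀ u → deg G u ≡ 0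
    isolated u = n≤0⇒n≡0 (*-cancelˡ-≤ (n G) {{>-nonZero n>0}} (≤-trans (max u) z≤n))
  main (suc t) k (suc l) G n>0 _ avg max =
    large-degree⇒ G n>0 (suc t) k l D threshold≤D (λ v → fits (max v))
      (≤-trans (≤-reflexive (*-comm (n G) D)) (m/n*n≤m (suc l * degSum G) (n G)))
    where
    instance
      n≢0 : NonZero (n G)
      n≢0 = >-nonZero n>0
    -- λ times the average degree, rounded down; since degrees are integers, it still bounds all of
    -- them.
    D = suc l * degSum G / n G
    fits : ∀ {d} → n G * d ≤ suc l * degSum G → d ≤ D
    fits {d} nd≤ = ≤-trans (≤-reflexive (sym (m*n/n≡m d (n G))))
      (/-monoˡ-≤ (n G) (≤-trans (≤-reflexive (*-comm d (n G))) nd≤))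
    threshold≤D = fits (≤-trans (≤-reflexive (*-comm (n G) _)) (≤-trans avg (m≤m+n (degSum G) _)))
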